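{- For every sufficiently large constant $d$ there is a constant $\gamma>0$ such that a uniformly random $2d$-regular (simple) graph on vertex set $[n]$ is $\gamma$-robustly self-ordered with probability $1-o(1)$ (as $n\to\infty$).
   Context: A graph $G=(V,E)$ is $\gamma$-robustly self-ordered if for every permutation $\pi:V\to V$, $|E\triangle\{\{\pi(u),\pi(v)\}:\{u,v\}\in E\}|\ge\gamma\cdot|\{v:\pi(v)\ne v\}|$. -}

module Defs where

open import Data.Bool using (Bool; true; false; _∧_; _∨_; not; _xor_)
open import Data.Nat using (ℕ; zero; suc; _<ᵇ_; _≡ᵇ_)
open import Data.Fin using (Fin; toℕ)
open import Data.Fin.Properties using (_≟_)
open import Data.Fin.Permutation using (Permutation′; _⟨$⟩ʳ_)
open import Data.List using (List; []; _∷_; length; filterᵇ; allFin; concatMap; map)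
open import Data.Bool.ListAction using (any)
open import Data.Product using (_×_; _,_; proj₁; proj₂)
open import Data.Vec using (Vec; lookup)
open import Data.Integer using (+_)
open import Data.Rational using (ℚ; _/_; _*_; _≤_)
open import Relation.Nullary.Decidable using (⌊_⌋)
open import Relation.Binary.PropositionalEquality using (_≡_)

Adj : ℕ → Set
Adj n = Vec (Vec Bool n) n

adj : ∀ {n} → Adj n → Fin n → Fin n → Bool
adj A u v = lookup (lookup A u) v

IsSimple : ∀ {n} → Adj n → Set
IsSimple {n} A = (∀ u v → adj A u v ≡ adj A v u) × (∀ u → adj A u u ≡ false)

countᵇ : ∀ {a} {X : Set a} → (X → Bool) → List X → ℕ
countᵇ p xs = length (filterᵇ p xs)

degree : ∀ {n} → Adj n → Fin n → ℕ
degree {n} A u = countᵇ (adj A u) (allFin n)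

IsRegular : ∀ {n} → ℕ → Adj n → Set
IsRegular {n} k A = ∀ u → degree A u ≡ k

IsSimpleRegular : ∀ {n} → ℕ → Adj n → Set
IsSimpleRegular k A = IsSimple A × IsRegular k A

_==_ : ∀ {n} → Fin n → Fin n → Bool
x == y = ⌊ x ≟ y ⌋

inImage : ∀ {n} → Adj n → Permutation′ n → Fin n → Fin n → Bool
inImage {n} A π x y =
  any (λ u → any (λ v → adj A u v ∧ (((π ⟨$⟩ʳ u) == x) ∧ ((π ⟨$⟩ʳ v) == y))) (allFin n)) (allFin n)

-- unordered pairs {u,v}, u ≠ v, listed once as (u,v) with u < v
pairs : ∀ n → List (Fin n × Fin n)
pairs n = concatMap (λ u → map (u ,_) (filterᵇ (λ v → toℕ u <ᵇ toℕ v) (allFin n))) (allFin n)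

symDiff : ∀ {n} → Adj n → Permutation′ n → ℕ
symDiff {n} A π = countᵇ (λ p → adj A (proj₁ p) (proj₂ p) xor inImage A π (proj₁ p) (proj₂ p)) (pairs n)

moved : ∀ {n} → Permutation′ n → ℕ
moved {n} π = countᵇ (λ v → not ((π ⟨$⟩ʳ v) == v)) (allFin n)

toℚ : ℕ → ℚ
toℚ m = + m / 1

RobustlySelfOrdered : ∀ {n} → ℚ → Adj n → Set
RobustlySelfOrdered {n} γ A = ∀ (π : Permutation′ n) → γ * toℚ (moved π) ≤ toℚ (symDiff A π)

-- Take γ = 1 and k = 2d ≥ 38. If π moves m points and changes fewer than m edges of A, a greedy choice
-- gives a list F of 5m edges of A at moved points whose preimages under π are also 5m distinct edges of A,
-- disjoint from F. For a list P of at most 10n pairs containing neither ab nor ba, switching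
-- ab, xy to ax, by shows that at most a fraction k²/n of the k-regular graphs containing P contain ab as
-- well. Removing the preimages of F one at a time, at most (k²/n)^5m times the number of k-regular graphs
-- containing F contain F and its preimage. For fixed moved points, each k-regular graph contains at most 2^km
-- such lists F, and there are at most n^2m ways to prescribe π on m points, so the bad graphs
-- for m are a fraction at most (k^10 2^k / n³)^m, and this is at most 1/n² once n ≥ k^10 2^k.
-- Summing over m ≤ n gives the bound 1/n.
module Submission where

open import Defs
open import Data.Nat using (ℕ; _≥_) renaming (_*_ to _*ℕ_)
open import Data.Rational using (ℚ; 0ℚ; _<_; _≤_; _*_)
open import Data.List using (List; length)
open import Data.List.Relation.Unary.All using (All)
open import Data.List.Relation.Unary.Unique.Propositional using (Unique)
open import Data.Product using (Σ; ∃; _×_)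
open import Relation.Nullary using (¬_)

open import Algebra.Properties.CommutativeSemigroup using (interchange; x∙yz≈y∙xz)
open import Data.Bool using (Bool; true; false; if_then_else_; not; T; T?; _xor_)
import Data.Bool.Properties as Bool
open import Data.Empty using (⊥; ⊥-elim)
open import Data.Fin using (Fin; toℕ)
open import Data.Fin.Permutation using (Permutation′; _⟨$⟩ʳ_; _⟨$⟩ˡ_; inverseˡ; inverseʳ)
open import Data.Fin.Permutation.Components using (transpose)
open import Data.Fin.Properties as Fin using (_≟_)
open import Data.Integer as ℤ using (+<+; +≤+)
import Data.Integer.Properties as ℤ
open import Data.List using ([]; _∷_; map; filter; filterᵇ; _++_; cartesianProduct; cartesianProductWith; allFin; upTo)
open import Data.List.Membership.DecPropositional using () renaming (_∈?_ to member?)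
open import Data.List.Membership.Propositional using (_∈_; _∉_; find; lose)
open import Data.List.Membership.Propositional.Properties
  using (∈-∃++; ∈-++⁺ˡ; ∈-++⁺ʳ; ∈-++⁻; ∈-filter⁺; ∈-filter⁻; ∈-map⁺; ∈-map⁻; ∈-cartesianProductWith⁺;
         ∈-cartesianProduct⁺; ∈-cartesianProduct⁻; ∈-allFin; ∈-upTo⁺; ∈-upTo⁻; ∈-concatMap⁺)
open import Data.List.Properties
  using (length-++; length-map; length-tabulate; length-upTo; length-filter; filter-++; map-++; map-cong; map-∘; map-id)
open import Data.List.Relation.Binary.Sublist.Propositional using (_⊆_; []; _∷_; _∷ʳ_; ⊆-trans; minimum)
open import Data.List.Relation.Binary.Sublist.Propositional.Properties using (filter-⊆; All-resp-⊆)
open import Data.List.Relation.Unary.All as All using ([]; _∷_; all?)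
import Data.List.Relation.Unary.All.Properties as All
open import Data.List.Relation.Unary.AllPairs as AllPairs using (AllPairs; allPairs?; []; _∷_)
open import Data.List.Relation.Unary.Any using (here; there)
open import Data.List.Relation.Unary.Any.Properties using (any⁻)
import Data.List.Relation.Unary.Unique.Propositional.Properties as Unique
open import Data.Nat using (zero; suc; _+_; _^_; _<ᵇ_; z≤n; s≤s; NonZero; >-nonZero) renaming (_≤_ to _≤ℕ_; _<_ to _<ℕ_)
open import Data.Nat.ListAction using (sum)
open import Data.Nat.ListAction.Properties using (sum-++)
open import Data.Nat.Properties as ℕ
  using (≤-refl; ≤-trans; ≤-reflexive; ≤-antisym; <⇒≤; <⇒<ᵇ; <-cmp; n≤1+n; m≤m+n; m≤n+m;
         +-comm; +-identityʳ; +-mono-≤; +-monoʳ-≤; +-cancelʳ-≤; +-commutativeSemigroup;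
         *-comm; *-assoc; *-identityʳ; *-zeroʳ; *-distribˡ-+; *-distribʳ-+; *-mono-≤; *-monoˡ-≤; *-monoʳ-≤; *-cancelˡ-≤;
         ^-monoˡ-≤; ^-*-assoc; m^n>0; m^n≢0; m*n≢0; module ≤-Reasoning)
  renaming (_≟_ to _≟ℕ_)
open import Data.Nat.Tactic.RingSolver using (solve-∀)
open import Data.Product using (_,_; proj₁; proj₂; swap)
open import Data.Product.Properties using (≡-dec)
open import Data.Rational using (mkℚ; 1ℚ; *<*; toℚᵘ; ↧ₙ_)
import Data.Rational.Properties as ℚ
open import Data.Rational.Unnormalised using (mkℚᵘ; *≤*) renaming (_≃_ to _≃ᵘ_; _*_ to _*ᵘ_)
import Data.Rational.Unnormalised.Properties as ℚᵘ
open import Data.Sum using (_⊎_; inj₁; inj₂)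
open import Data.Unit using (tt)
open import Data.Vec as Vec using (Vec; lookup; tabulate; toList)
import Data.Vec.Properties as Vec
open import Function using (_∘_; const; Equivalence)
open import Relation.Binary using (tri<; tri≈; tri>) renaming (Decidable to Decidable₂)
open import Relation.Binary.PropositionalEquality
  using (_≡_; _≢_; refl; sym; trans; cong; cong₂; subst; subst₂; module ≡-Reasoning)
open import Relation.Nullary using (Dec; yes; no; does)
open import Relation.Nullary.Decidable
  using (_×-dec_; _⊎-dec_; ¬?; dec-true; dec-false; toWitness; toWitnessFalse; fromWitnessFalse; decidable-stable)
open import Relation.Unary using (Pred; Decidable)

-- Sums and counting over lists

∑ : ∀ {a} {X : Set a} → List X → (X → ℕ) → ℕ
∑ xs f = sum (map f xs)

syntax ∑ xs (λ x → e) = ∑[ x ← xs ] e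

module _ {a} {X : Set a} where

  ∑-++ : ∀ xs ys (f : X → ℕ) → ∑ (xs ++ ys) f ≡ ∑ xs f + ∑ ys f
  ∑-++ xs ys f = trans (cong sum (map-++ f xs ys)) (sum-++ (map f xs) (map f ys))

  ∑-cong : ∀ {f g : X → ℕ} → (∀ x → f x ≡ g x) → ∀ xs → ∑ xs f ≡ ∑ xs g
  ∑-cong f≗g xs = cong sum (map-cong f≗g xs)

  ∑-cong-∈ : ∀ xs {f g : X → ℕ} → (∀ {x} → x ∈ xs → f x ≡ g x) → ∑ xs f ≡ ∑ xs g
  ∑-cong-∈ []       f≗g = refl
  ∑-cong-∈ (x ∷ xs) f≗g = cong₂ _+_ (f≗g (here refl)) (∑-cong-∈ xs (f≗g ∘ there))

  ∑-mono : ∀ xs {f g : X → ℕ} → (∀ {x} → x ∈ xs → f x ≤ℕ g x) → ∑ xs f ≤ℕ ∑ xs g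
  ∑-mono []       f≤g = z≤n
  ∑-mono (x ∷ xs) f≤g = +-mono-≤ (f≤g (here refl)) (∑-mono xs (f≤g ∘ there))

  ∑-const : ∀ (xs : List X) c → ∑ xs (const c) ≡ length xs *ℕ c
  ∑-const []       c = refl
  ∑-const (x ∷ xs) c = cong (c +_) (∑-const xs c)

  ∑-+ : ∀ xs (f g : X → ℕ) → ∑[ x ← xs ] (f x + g x) ≡ ∑ xs f + ∑ xs g
  ∑-+ []       f g = refl
  ∑-+ (x ∷ xs) f g = trans (cong (f x + g x +_) (∑-+ xs f g)) (interchange +-commutativeSemigroup (f x) (g x) (∑ xs f) (∑ xs g))

  ∑-*ʳ : ∀ xs (f : X → ℕ) c → ∑[ x ← xs ] (f x *ℕ c) ≡ ∑ xs f *ℕ c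
  ∑-*ʳ []       f c = refl
  ∑-*ʳ (x ∷ xs) f c = trans (cong (f x *ℕ c +_) (∑-*ʳ xs f c)) (sym (*-distribʳ-+ c (f x) _))

  ∑-*ˡ : ∀ xs (f : X → ℕ) c → ∑[ x ← xs ] (c *ℕ f x) ≡ c *ℕ ∑ xs f
  ∑-*ˡ []       f c = sym (*-zeroʳ c)
  ∑-*ˡ (x ∷ xs) f c = trans (cong (c *ℕ f x +_) (∑-*ˡ xs f c)) (sym (*-distribˡ-+ c (f x) _))

  ∑-lower : ∀ {x xs} (f : X → ℕ) → x ∈ xs → f x ≤ℕ ∑ xs f
  ∑-lower f (here refl) = m≤m+n _ _
  ∑-lower f (there x∈)  = ≤-trans (∑-lower f x∈) (m≤n+m _ _)

  -- Induction on `xs`: one occurrence of `x` is cut out of `ys`, and since `x` does not recur in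
  -- `xs`, the remaining elements lie in what is left.
  ∑-⊆ : ∀ {xs ys} (f : X → ℕ) → Unique xs → (∀ {x} → x ∈ xs → x ∈ ys) → ∑ xs f ≤ℕ ∑ ys f
  ∑-⊆ f []         sub = z≤n
  ∑-⊆ {x ∷ xs} f (x∉xs ∷ xs!) sub with ∈-∃++ (sub (here refl))
  ... | as , bs , refl = begin
    f x + ∑ xs f          ≤⟨ +-monoʳ-≤ (f x) (∑-⊆ f xs! sub′) ⟩
    f x + ∑ (as ++ bs) f  ≡⟨ cong (f x +_) (∑-++ as bs f) ⟩
    f x + (∑ as f + ∑ bs f) ≡⟨ x∙yz≈y∙xz +-commutativeSemigroup (f x) (∑ as f) (∑ bs f) ⟩
    ∑ as f + (f x + ∑ bs f) ≡⟨ ∑-++ as (x ∷ bs) f ⟨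
    ∑ (as ++ x ∷ bs) f    ∎
    where
    open ≤-Reasoning
    sub′ : ∀ {y} → y ∈ xs → y ∈ as ++ bs
    sub′ y∈ with ∈-++⁻ as (sub (there y∈))
    ... | inj₁ y∈as         = ∈-++⁺ˡ y∈as
    ... | inj₂ (here refl)  = ⊥-elim (All.lookup x∉xs y∈ refl)
    ... | inj₂ (there y∈bs) = ∈-++⁺ʳ as y∈bs

  length-⊆ : ∀ {xs ys : List X} → Unique xs → (∀ {x} → x ∈ xs → x ∈ ys) → length xs ≤ℕ length ys
  length-⊆ {xs} {ys} xs! sub = begin
    length xs        ≡⟨ ∑-one xs ⟨
    ∑ xs (const 1)   ≤⟨ ∑-⊆ (const 1) xs! sub ⟩
    ∑ ys (const 1)   ≡⟨ ∑-one ys ⟩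
    length ys        ∎
    where
    open ≤-Reasoning
    ∑-one : ∀ zs → ∑ zs (const 1) ≡ length zs
    ∑-one []       = refl
    ∑-one (z ∷ zs) = cong suc (∑-one zs)

∑-swap : ∀ {a b} {X : Set a} {Y : Set b} xs ys (f : X → Y → ℕ) →
         ∑[ x ← xs ] ∑[ y ← ys ] f x y ≡ ∑[ y ← ys ] ∑[ x ← xs ] f x y
∑-swap []       ys f = sym (trans (∑-const ys 0) (*-zeroʳ (length ys)))
∑-swap (x ∷ xs) ys f = trans (cong (∑ ys (f x) +_) (∑-swap xs ys f)) (sym (∑-+ ys (f x) _))

-- Indicators and numbers of list members with a property

⟦_⟧ : ∀ {p} {P : Set p} → Dec P → ℕ
⟦ P? ⟧ = if does P? then 1 else 0

-- This and `≤-*-⟦⟧` are the termwise lower and upper estimates of a double count in which only the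
-- objects satisfying `P` contribute.
⟦⟧-*-≤ : ∀ {p} {P : Set p} (P? : Dec P) {m c} → (P → c ≤ℕ m) → ⟦ P? ⟧ *ℕ c ≤ℕ m
⟦⟧-*-≤ (yes p) {c = c} c≤m = ≤-trans (≤-reflexive (+-identityʳ c)) (c≤m p)
⟦⟧-*-≤ (no _)  c≤m = z≤n

≤-*-⟦⟧ : ∀ {p} {P : Set p} (P? : Dec P) {m c} → (P → m ≤ℕ c) → (¬ P → m ≡ 0) → m ≤ℕ c *ℕ ⟦ P? ⟧
≤-*-⟦⟧ (yes p) {c = c} m≤c m≡0 = ≤-trans (m≤c p) (≤-reflexive (sym (*-identityʳ c)))
≤-*-⟦⟧ (no ¬p) m≤c m≡0 = ≤-trans (≤-reflexive (m≡0 ¬p)) z≤n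

⟦⟧-yes : ∀ {p} {P : Set p} (P? : Dec P) → P → ⟦ P? ⟧ ≡ 1
⟦⟧-yes (yes _) p = refl
⟦⟧-yes (no ¬p) p = ⊥-elim (¬p p)

module _ {a p} {X : Set a} {P : Pred X p} (P? : Decidable P) where

  # : List X → ℕ
  # xs = length (filter P? xs)

  #-∑ : ∀ xs → # xs ≡ ∑[ x ← xs ] ⟦ P? x ⟧
  #-∑ []       = refl
  #-∑ (x ∷ xs) with does (P? x)
  ... | true  = cong suc (#-∑ xs)
  ... | false = #-∑ xs

  #-none : (∀ x → ¬ P x) → ∀ xs → # xs ≡ 0
  #-none ¬p []       = refl
  #-none ¬p (x ∷ xs) with P? x
  ... | yes p = ⊥-elim (¬p x p)
  ... | no _  = #-none ¬p xs

  ∑-filter : ∀ xs (f : X → ℕ) → ∑ (filter P? xs) f ≤ℕ ∑ xs f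
  ∑-filter []       f = z≤n
  ∑-filter (x ∷ xs) f with does (P? x)
  ... | true  = +-monoʳ-≤ (f x) (∑-filter xs f)
  ... | false = ≤-trans (∑-filter xs f) (m≤n+m _ _)

  #-++ : ∀ xs ys → # (xs ++ ys) ≡ # xs + # ys
  #-++ xs ys = trans (cong length (filter-++ P? xs ys)) (length-++ (filter P? xs))

#-map : ∀ {a b p} {X : Set a} {Y : Set b} {P : Pred Y p} (P? : Decidable P) (f : X → Y) xs →
        # P? (map f xs) ≡ # (P? ∘ f) xs
#-map P? f []       = refl
#-map P? f (x ∷ xs) with does (P? (f x))
... | true  = cong suc (#-map P? f xs)
... | false = #-map P? f xs

#-cartesianProduct : ∀ {a b p} {X : Set a} {Y : Set b} {P : Pred (X × Y) p} (P? : Decidable P) xs ys →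
                     # P? (cartesianProduct xs ys) ≡ ∑[ x ← xs ] # (λ y → P? (x , y)) ys
#-cartesianProduct P? []       ys = refl
#-cartesianProduct P? (x ∷ xs) ys =
  trans (#-++ P? (map (x ,_) ys) (cartesianProduct xs ys))
        (cong₂ _+_ (#-map P? (x ,_) ys) (#-cartesianProduct P? xs ys))

module _ {a b p q} {X : Set a} {Y : Set b} {P : Pred X p} {Q : Pred Y q}
         (P? : Decidable P) (Q? : Decidable Q) where

  #-injection : ∀ {xs ys} (f : X → Y) → (∀ {x x′} → f x ≡ f x′ → x ≡ x′) → Unique xs →
                (∀ {x} → x ∈ xs → P x → f x ∈ ys × Q (f x)) → # P? xs ≤ℕ # Q? ys
  #-injection {xs} {ys} f inj xs! into =
    subst (_≤ℕ # Q? ys) (length-map f (filter P? xs))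
      (length-⊆ (Unique.map⁺ inj (Unique.filter⁺ P? xs!)) sub)
    where
    sub : ∀ {y} → y ∈ map f (filter P? xs) → y ∈ filter Q? ys
    sub y∈ with ∈-map⁻ f y∈
    ... | x , x∈ , refl with ∈-filter⁻ P? x∈
    ...   | x∈xs , px with into x∈xs px
    ...     | fx∈ys , qfx = ∈-filter⁺ Q? fx∈ys qfx

length-cartesianProduct : ∀ {a b} {X : Set a} {Y : Set b} (xs : List X) (ys : List Y) →
                          length (cartesianProduct xs ys) ≡ length xs *ℕ length ys
length-cartesianProduct []       ys = refl
length-cartesianProduct (x ∷ xs) ys =
  trans (length-++ (map (x ,_) ys)) (cong₂ _+_ (length-map (x ,_) ys) (length-cartesianProduct xs ys))

-- Enumeration of sublists and of vectors

sublists : ∀ {a} {X : Set a} → List X → List (List X)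
sublists []       = [] ∷ []
sublists (x ∷ xs) = sublists xs ++ map (x ∷_) (sublists xs)

∈-sublists : ∀ {a} {X : Set a} {xs ys : List X} → xs ⊆ ys → xs ∈ sublists ys
∈-sublists []         = here refl
∈-sublists (y ∷ʳ xs⊆) = ∈-++⁺ˡ (∈-sublists xs⊆)
∈-sublists {ys = y ∷ ys} (refl ∷ xs⊆) = ∈-++⁺ʳ (sublists ys) (∈-map⁺ (y ∷_) (∈-sublists xs⊆))

#-sublists : ∀ {a p} {X : Set a} {P : Pred X p} (P? : Decidable P) xs →
             # (all? P?) (sublists xs) ≡ 2 ^ # P? xs
#-sublists P? []       = refl
#-sublists P? (x ∷ xs) = trans (#-++ (all? P?) (sublists xs) _)
  (trans (cong (# (all? P?) (sublists xs) +_) (#-map (all? P?) (x ∷_) (sublists xs))) (step (P? x) refl))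
  where
  #-some : ∀ ys → does (P? x) ≡ true → # (λ ys → all? P? (x ∷ ys)) ys ≡ # (all? P?) ys
  #-some []       e = refl
  #-some (y ∷ ys) e rewrite e with does (all? P? y)
  ... | true  = cong suc (#-some ys e)
  ... | false = #-some ys e
  step : (d : Dec _) → P? x ≡ d →
         # (all? P?) (sublists xs) + # (λ ys → all? P? (x ∷ ys)) (sublists xs) ≡ 2 ^ # P? (x ∷ xs)
  step (yes _) e rewrite #-some (sublists xs) (cong does e) | e | #-sublists P? xs =
    cong (2 ^ # P? xs +_) (sym (+-identityʳ _))
  step (no ¬p) e rewrite #-none (λ ys → all? P? (x ∷ ys)) (λ { _ (p ∷ _) → ¬p p }) (sublists xs) | e =
    trans (+-identityʳ _) (#-sublists P? xs)

vectors : ∀ {a} {X : Set a} → List X → ∀ n → List (Vec X n)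
vectors xs zero    = Vec.[] ∷ []
vectors xs (suc n) = cartesianProductWith Vec._∷_ xs (vectors xs n)

module _ {a} {X : Set a} {xs : List X} where

  ∈-vectors : (∀ x → x ∈ xs) → ∀ {n} (v : Vec X n) → v ∈ vectors xs n
  ∈-vectors ∈xs Vec.[]      = here refl
  ∈-vectors ∈xs (x Vec.∷ v) = ∈-cartesianProductWith⁺ Vec._∷_ (∈xs x) (∈-vectors ∈xs v)

  vectors-unique : Unique xs → ∀ n → Unique (vectors xs n)
  vectors-unique xs! zero    = [] ∷ []
  vectors-unique xs! (suc n) = Unique.cartesianProductWith⁺ Vec._∷_ Vec.∷-injective xs! (vectors-unique xs! n)

  length-vectors : ∀ n → length (vectors xs n) ≡ length xs ^ n
  length-vectors zero    = refl
  length-vectors (suc n) = trans (length-cartesianProductWith xs) (cong (length xs *ℕ_) (length-vectors n))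
    where
    length-cartesianProductWith : ∀ ys → length (cartesianProductWith Vec._∷_ ys (vectors xs n)) ≡ length ys *ℕ length (vectors xs n)
    length-cartesianProductWith []       = refl
    length-cartesianProductWith (y ∷ ys) = trans (length-++ (map (y Vec.∷_) (vectors xs n)))
      (cong₂ _+_ (length-map (y Vec.∷_) (vectors xs n)) (length-cartesianProductWith ys))

-- Pairs, edges and switchings

¬T⇒≡false : ∀ {b} → ¬ T b → b ≡ false
¬T⇒≡false {false} ¬t = refl
¬T⇒≡false {true}  ¬t = ⊥-elim (¬t tt)

T-true : ∀ {b} → T b → b ≡ true
T-true {true} _ = refl

module _ {n : ℕ} where

  transpose-matchˡ : ∀ (i j : Fin n) → transpose i j i ≡ j
  transpose-matchˡ i j rewrite dec-true (i ≟ i) refl = refl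

  transpose-matchʳ : ∀ (i j : Fin n) → transpose i j j ≡ i
  transpose-matchʳ i j with j ≟ i
  ... | yes j≡i = j≡i
  ... | no _ rewrite dec-true (j ≟ j) refl = refl

  transpose-else : ∀ {i j k : Fin n} → k ≢ i → k ≢ j → transpose i j k ≡ k
  transpose-else {i} {j} {k} k≢i k≢j rewrite dec-false (k ≟ i) k≢i | dec-false (k ≟ j) k≢j = refl

  transpose-involutive : ∀ (i j : Fin n) k → transpose i j (transpose i j k) ≡ k
  transpose-involutive i j k with k ≟ i
  ... | yes refl = transpose-matchʳ k j
  ... | no k≢i with k ≟ j
  ...   | yes refl = transpose-matchˡ i k
  ...   | no k≢j   = transpose-else k≢i k≢j

Pair : ℕ → Set
Pair n = Fin n × Fin n

Edge : ∀ {n} → Adj n → Pair n → Set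
Edge A (u , v) = T (adj A u v)

edge? : ∀ {n} (A : Adj n) → Decidable (Edge A)
edge? A (u , v) = T? (adj A u v)

_⊇?_ : ∀ {n} (A : Adj n) (P : List (Pair n)) → Dec (All (Edge A) P)
A ⊇? P = all? (edge? A) P

allPairs : ∀ n → List (Pair n)
allPairs n = cartesianProduct (allFin n) (allFin n)

∈-allPairs : ∀ {n} (p : Pair n) → p ∈ allPairs n
∈-allPairs (u , v) = ∈-cartesianProduct⁺ (∈-allFin u) (∈-allFin v)

allPairs-unique : ∀ n → Unique (allPairs n)
allPairs-unique n = Unique.cartesianProduct⁺ (Unique.allFin⁺ n) (Unique.allFin⁺ n)

adj-ext : ∀ {n} {A B : Adj n} → (∀ u v → adj A u v ≡ adj B u v) → A ≡ B
adj-ext {A = A} {B} A≗B =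
  trans (sym (Vec.tabulate∘lookup A))
    (trans (Vec.tabulate-cong λ u →
       trans (sym (Vec.tabulate∘lookup (lookup A u)))
         (trans (Vec.tabulate-cong (A≗B u)) (Vec.tabulate∘lookup (lookup B u))))
    (Vec.tabulate∘lookup B))

_≟ᵖ_ : ∀ {n} (p q : Pair n) → Dec (p ≡ q)
_≟ᵖ_ = ≡-dec _≟_ _≟_

infix 4 _≁_ _≁?_ _∈ᶠ?_ _∈ᵖ?_

-- Distinctness as unordered pairs: edges are stored as ordered pairs, so both orientations have to
-- be ruled out.
_≁_ : ∀ {n} → Pair n → Pair n → Set
p ≁ q = p ≢ q × p ≢ swap q

_≁?_ : ∀ {n} (p q : Pair n) → Dec (p ≁ q)
p ≁? q = ¬? (p ≟ᵖ q) ×-dec ¬? (p ≟ᵖ swap q)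

_∈ᶠ?_ : ∀ {n} (u : Fin n) xs → Dec (u ∈ xs)
_∈ᶠ?_ = member? _≟_

_∈ᵖ?_ : ∀ {n} (p : Pair n) xs → Dec (p ∈ xs)
_∈ᵖ?_ = member? _≟ᵖ_

neighbours : ∀ {n} → Adj n → Fin n → List (Fin n)
neighbours {n} A u = filter (λ v → edge? A (u , v)) (allFin n)

∈-neighbours : ∀ {n} (A : Adj n) {u v} → Edge A (u , v) → v ∈ neighbours A u
∈-neighbours A {u} {v} = ∈-filter⁺ (λ v → edge? A (u , v)) (∈-allFin v)

-- Replacing the edges ab, xy by ax, by amounts to transposing b and x in the rows of a and y, and
-- a and y in the rows of b and x. In this form it is visibly involutive and preserves degrees.
module Switch {n} (a b x y : Fin n) where

  ay? : ∀ u → Dec (u ≡ a ⊎ u ≡ y)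
  ay? u = (u ≟ a) ⊎-dec (u ≟ y)

  bx? : ∀ u → Dec (u ≡ b ⊎ u ≡ x)
  bx? u = (u ≟ b) ⊎-dec (u ≟ x)

  row : Fin n → Fin n → Fin n
  row u with ay? u | bx? u
  ... | yes _ | _     = transpose b x
  ... | no _  | yes _ = transpose a y
  ... | no _  | no _  = λ v → v

  row-involutive : ∀ u v → row u (row u v) ≡ v
  row-involutive u v with ay? u | bx? u
  ... | yes _ | _     = transpose-involutive b x v
  ... | no _  | yes _ = transpose-involutive a y v
  ... | no _  | no _  = refl

  row-injective : ∀ u {v w} → row u v ≡ row u w → v ≡ w
  row-injective u {v} {w} eq =
    trans (sym (row-involutive u v)) (trans (cong (row u) eq) (row-involutive u w))

  switch : Adj n → Adj n
  switch A = tabulate λ u → tabulate λ v → adj A u (row u v)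

  adj-switch : ∀ A u v → adj (switch A) u v ≡ adj A u (row u v)
  adj-switch A u v =
    trans (cong (λ r → lookup r v) (Vec.lookup∘tabulate (λ u → tabulate λ v → adj A u (row u v)) u))
          (Vec.lookup∘tabulate (λ v → adj A u (row u v)) v)

  switch-involutive : ∀ A → switch (switch A) ≡ A
  switch-involutive A = adj-ext λ u v →
    trans (adj-switch (switch A) u v)
      (trans (adj-switch A u (row u v)) (cong (adj A u) (row-involutive u v)))

  switch-injective : ∀ {A B} → switch A ≡ switch B → A ≡ B
  switch-injective {A} {B} eq =
    trans (sym (switch-involutive A)) (trans (cong switch eq) (switch-involutive B))

  -- Row `u` of the switched matrix is row `u` of `A` with its columns permuted by the involution
  -- `row u`, which therefore injects the neighbours of `u` in either graph into those in the other.
  degree-switch : ∀ A u → degree (switch A) u ≡ degree A u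
  degree-switch A u = ≤-antisym
    (#-injection (λ v → edge? (switch A) (u , v)) (λ v → edge? A (u , v)) (row u) (row-injective u)
      (Unique.allFin⁺ n) λ {v} _ t → ∈-allFin (row u v) , subst T (adj-switch A u v) t)
    (#-injection (λ v → edge? A (u , v)) (λ v → edge? (switch A) (u , v)) (row u) (row-injective u)
      (Unique.allFin⁺ n) λ {v} _ t → ∈-allFin (row u v) ,
        subst T (sym (trans (adj-switch A u (row u v)) (cong (adj A u) (row-involutive u v)))) t)

  module _ (A : Adj n) (simple : IsSimple A)
           (ab : Edge A (a , b)) (xy : Edge A (x , y))
           (¬ax : ¬ Edge A (a , x)) (¬by : ¬ Edge A (b , y))
           (a≢x : a ≢ x) (b≢x : b ≢ x) (a≢y : a ≢ y) (b≢y : b ≢ y) where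

    private
      symm = proj₁ simple

      loopless : ∀ {u v} → Edge A (u , v) → u ≢ v
      loopless {u} uv refl = subst T (proj₂ simple u) uv

      a≢b = loopless ab
      x≢y = loopless xy

      ay∩bx : ∀ {u} → u ≡ a ⊎ u ≡ y → u ≡ b ⊎ u ≡ x → ⊥
      ay∩bx (inj₁ refl) (inj₁ refl) = a≢b refl
      ay∩bx (inj₁ refl) (inj₂ refl) = a≢x refl
      ay∩bx (inj₂ refl) (inj₁ refl) = b≢y refl
      ay∩bx (inj₂ refl) (inj₂ refl) = x≢y refl

    row-ay : ∀ {u} → u ≡ a ⊎ u ≡ y → ∀ v → row u v ≡ transpose b x v
    row-ay {u} u∈ v with ay? u | bx? u
    ... | yes _  | _ = refl
    ... | no ¬ay | _ = ⊥-elim (¬ay u∈)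

    row-bx : ∀ {u} → u ≡ b ⊎ u ≡ x → ∀ v → row u v ≡ transpose a y v
    row-bx {u} u∈ v with ay? u | bx? u
    ... | yes ay | _      = ⊥-elim (ay∩bx ay u∈)
    ... | no _   | yes _  = refl
    ... | no _   | no ¬bx = ⊥-elim (¬bx u∈)

    -- The positions that switching can alter: both orientations of ab, ax, yb and yx.
    data Crossing (u v : Fin n) : Set where
      ay-bx : u ≡ a ⊎ u ≡ y → v ≡ b ⊎ v ≡ x → Crossing u v
      bx-ay : u ≡ b ⊎ u ≡ x → v ≡ a ⊎ v ≡ y → Crossing u v


    crossing? : ∀ u v → Crossing u v ⊎ row u v ≡ v
    crossing? u v with ay? u | bx? u
    crossing? u v | yes p | _ with bx? v
    ... | yes q = inj₁ (ay-bx p q)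
    ... | no ¬q = inj₂ (transpose-else (¬q ∘ inj₁) (¬q ∘ inj₂))
    crossing? u v | no _ | yes p with ay? v
    ... | yes q = inj₁ (bx-ay p q)
    ... | no ¬q = inj₂ (transpose-else (¬q ∘ inj₁) (¬q ∘ inj₂))
    crossing? u v | no _ | no _ = inj₂ refl

    noncrossing : ∀ {u v} → ¬ Crossing u v → row u v ≡ v
    noncrossing {u} {v} ¬c with crossing? u v
    ... | inj₁ c = ⊥-elim (¬c c)
    ... | inj₂ e = e

    -- Symmetry at the four altered places: the two sides read the non-edges ax and by at ab and at
    -- yx, and the edges ab and xy at ax and at yb.
    row-crossing : ∀ {u v} → u ≡ a ⊎ u ≡ y → v ≡ b ⊎ v ≡ x → adj A u (row u v) ≡ adj A v (row v u)
    row-crossing p@(inj₁ refl) q@(inj₁ refl) rewrite row-ay p b | row-bx q a | transpose-matchˡ b x | transpose-matchˡ a y =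
      trans (¬T⇒≡false ¬ax) (sym (¬T⇒≡false ¬by))
    row-crossing p@(inj₁ refl) q@(inj₂ refl) rewrite row-ay p x | row-bx q a | transpose-matchʳ b x | transpose-matchˡ a y =
      trans (T-true ab) (sym (T-true xy))
    row-crossing p@(inj₂ refl) q@(inj₁ refl) rewrite row-ay p b | row-bx q y | transpose-matchˡ b x | transpose-matchʳ a y =
      trans (symm y x) (trans (T-true xy) (sym (trans (symm b a) (T-true ab))))
    row-crossing p@(inj₂ refl) q@(inj₂ refl) rewrite row-ay p x | row-bx q y | transpose-matchʳ b x | transpose-matchʳ a y =
      trans (symm y b) (trans (¬T⇒≡false ¬by) (sym (trans (symm x a) (¬T⇒≡false ¬ax))))

    row-sym : ∀ u v → adj A u (row u v) ≡ adj A v (row v u)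
    row-sym u v with crossing? u v
    ... | inj₁ (ay-bx p q) = row-crossing p q
    ... | inj₁ (bx-ay p q) = sym (row-crossing q p)
    ... | inj₂ e with crossing? v u
    ...   | inj₁ (ay-bx p q) = sym (row-crossing p q)
    ...   | inj₁ (bx-ay p q) = row-crossing q p
    ...   | inj₂ e′ = trans (cong (adj A u) e) (trans (symm u v) (cong (adj A v) (sym e′)))

    switch-simple : IsSimple (switch A)
    switch-simple =
      (λ u v → trans (adj-switch A u v) (trans (row-sym u v) (sym (adj-switch A v u)))) ,
      (λ u → trans (adj-switch A u u)
        (trans (cong (adj A u) (noncrossing λ { (ay-bx p q) → ay∩bx p q ; (bx-ay p q) → ay∩bx q p }))
               (proj₂ simple u)))

    switch-new-ax : Edge (switch A) (a , x)
    switch-new-ax = subst T (sym (trans (adj-switch A a x)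
      (cong (adj A a) (trans (row-ay (inj₁ refl) x) (transpose-matchʳ b x))))) ab

    switch-new-by : Edge (switch A) (b , y)
    switch-new-by = subst T (sym (trans (adj-switch A b y)
      (trans (cong (adj A b) (trans (row-bx (inj₁ refl) y) (transpose-matchʳ a y))) (symm b a)))) ab

    -- An edge can be lost only at an altered position. Among these ax and by are non-edges of `A`,
    -- so such an edge is ab or xy, which the hypotheses exclude.
    switch-old : ∀ {p} → (a , b) ≁ p → (x , y) ≁ p → Edge A p → Edge (switch A) p
    switch-old {u , v} ab≁ xy≁ uv =
      subst T (sym (trans (adj-switch A u v) (cong (adj A u) (noncrossing ¬c)))) uv
      where
      ¬c : ¬ Crossing u v
      ¬c (ay-bx (inj₁ refl) (inj₁ refl)) = proj₁ ab≁ refl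
      ¬c (ay-bx (inj₁ refl) (inj₂ refl)) = ¬ax uv
      ¬c (ay-bx (inj₂ refl) (inj₁ refl)) = ¬by (subst T (symm y b) uv)
      ¬c (ay-bx (inj₂ refl) (inj₂ refl)) = proj₂ xy≁ refl
      ¬c (bx-ay (inj₁ refl) (inj₁ refl)) = proj₂ ab≁ refl
      ¬c (bx-ay (inj₂ refl) (inj₁ refl)) = ¬ax (subst T (symm x a) uv)
      ¬c (bx-ay (inj₁ refl) (inj₂ refl)) = ¬by uv
      ¬c (bx-ay (inj₂ refl) (inj₂ refl)) = proj₁ xy≁ refl

-- Counting regular graphs that contain prescribed edges

regular? : ∀ k {n} → Decidable (IsSimpleRegular {n} k)
regular? k A =
  (Fin.all? (λ u → Fin.all? λ v → adj A u v Bool.≟ adj A v u) ×-dec Fin.all? (λ u → adj A u u Bool.≟ false))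
  ×-dec Fin.all? (λ u → degree A u ≟ℕ k)

bools : List Bool
bools = false ∷ true ∷ []

∈-bools : ∀ b → b ∈ bools
∈-bools false = here refl
∈-bools true  = there (here refl)

bools-unique : Unique bools
bools-unique = ((λ ()) ∷ []) ∷ [] ∷ []

regulars : ∀ k n → List (Adj n)
regulars k n = filter (regular? k) (vectors (vectors bools n) n)

regulars-unique : ∀ k n → Unique (regulars k n)
regulars-unique k n = Unique.filter⁺ (regular? k) (vectors-unique (vectors-unique bools-unique n) n)

∈-regulars : ∀ {k n} {A : Adj n} → IsSimpleRegular k A → A ∈ regulars k n
∈-regulars {k} {n} {A} = ∈-filter⁺ (regular? k) (∈-vectors (∈-vectors ∈-bools) A)

regulars-sound : ∀ k {n} {A : Adj n} → A ∈ regulars k n → IsSimpleRegular k A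
regulars-sound k {n} A∈ = proj₂ (∈-filter⁻ (regular? k) {xs = vectors (vectors bools n) n} A∈)

#-edges : ∀ {k n} (A : Adj n) → IsRegular k A → ∀ us → # (edge? A) (cartesianProduct us (allFin n)) ≡ length us *ℕ k
#-edges {k} {n} A reg us = trans (#-cartesianProduct (edge? A) us (allFin n))
  (trans (∑-cong reg us) (∑-const us k))

module _ (k n : ℕ) where

  extensions : List (Pair n) → ℕ
  extensions P = # (_⊇? P) (regulars k n)

  module _ (a b : Fin n) (P : List (Pair n)) where

    -- The ordered edges xy that can be switched with ab so that ax and by are new, no loop arises,
    -- and no edge of `P` is used up through xy.
    Switchable : Adj n → Pair n → Set
    Switchable A (x , y) = Edge A (x , y) × x ∉ a ∷ b ∷ neighbours A a × y ∉ a ∷ b ∷ neighbours A b ×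
                           (x , y) ∉ P × (x , y) ∉ map swap P

    switchable? : ∀ A → Decidable (Switchable A)
    switchable? A (x , y) = edge? A (x , y) ×-dec ¬? (x ∈ᶠ? _) ×-dec ¬? (y ∈ᶠ? _) ×-dec
                            ¬? ((x , y) ∈ᵖ? P) ×-dec ¬? ((x , y) ∈ᵖ? map swap P)

    -- There are nk ordered edges. Those with `x` among the 2 + k excluded vertices number (2 + k)k,
    -- likewise for `y`, and `P` excludes at most two orientations of each of its members.
    #-switchable : ∀ A → IsSimpleRegular k A →
                   n *ℕ k ≤ℕ # (switchable? A) (allPairs n) + (2 *ℕ ((2 + k) *ℕ k) + 2 *ℕ length P)
    #-switchable A ((symm , _) , reg) = begin
      n *ℕ k
        ≡⟨ cong (_*ℕ k) (length-tabulate {n = n} (λ v → v)) ⟨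
      length (allFin n) *ℕ k
        ≡⟨ #-edges A reg (allFin n) ⟨
      # (edge? A) (allPairs n)
        ≤⟨ length-⊆ (Unique.filter⁺ (edge? A) (allPairs-unique n)) cover ⟩
      length (good ++ (X ++ map swap Y) ++ (P ++ map swap P))
        ≡⟨ length-++ good ⟩
      length good + length ((X ++ map swap Y) ++ (P ++ map swap P))
        ≡⟨ cong (length good +_) (length-++ (X ++ map swap Y)) ⟩
      length good + (length (X ++ map swap Y) + length (P ++ map swap P))
        ≡⟨ cong (length good +_) (cong₂ _+_
             (trans (length-++ X) (cong₂ _+_ (near a) (trans (length-map swap Y) (near b))))
             (trans (length-++ P) (cong (length P +_) (length-map swap P)))) ⟩
      length good + (((2 + k) *ℕ k + (2 + k) *ℕ k) + (length P + length P))
        ≡⟨ cong (length good +_) (double ((2 + k) *ℕ k) (length P)) ⟩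
      length good + (2 *ℕ ((2 + k) *ℕ k) + 2 *ℕ length P) ∎
      where
      open ≤-Reasoning
      double : ∀ r s → r + r + (s + s) ≡ 2 *ℕ r + 2 *ℕ s
      double = solve-∀
      good = filter (switchable? A) (allPairs n)
      nbhd : Fin n → List (Fin n)
      nbhd c = a ∷ b ∷ neighbours A c
      X = filter (edge? A) (cartesianProduct (nbhd a) (allFin n))
      -- Edges excluded because of `y` are listed as leaving `y`, and reversed in `cover`, so that
      -- the same degree sum counts them.
      Y = filter (edge? A) (cartesianProduct (nbhd b) (allFin n))
      near : ∀ c → # (edge? A) (cartesianProduct (nbhd c) (allFin n)) ≡ (2 + k) *ℕ k
      near c = trans (#-edges A reg (nbhd c)) (cong (λ r → (2 + r) *ℕ k) (reg c))
      cover : ∀ {p} → p ∈ filter (edge? A) (allPairs n) → p ∈ good ++ (X ++ map swap Y) ++ (P ++ map swap P)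
      cover {x , y} p∈ with proj₂ (∈-filter⁻ (edge? A) {xs = allPairs n} p∈)
      ... | xy with x ∈ᶠ? nbhd a
      ... | yes x∈ = ∈-++⁺ʳ good (∈-++⁺ˡ (∈-++⁺ˡ
              (∈-filter⁺ (edge? A) (∈-cartesianProduct⁺ x∈ (∈-allFin y)) xy)))
      ... | no x∉ with y ∈ᶠ? nbhd b
      ... | yes y∈ = ∈-++⁺ʳ good (∈-++⁺ˡ (∈-++⁺ʳ X (∈-map⁺ swap
              (∈-filter⁺ (edge? A) (∈-cartesianProduct⁺ y∈ (∈-allFin x)) (subst T (symm x y) xy)))))
      ... | no y∉ with (x , y) ∈ᵖ? P
      ... | yes p∈P = ∈-++⁺ʳ good (∈-++⁺ʳ (X ++ map swap Y) (∈-++⁺ˡ p∈P))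
      ... | no p∉P with (x , y) ∈ᵖ? map swap P
      ... | yes p∈P′ = ∈-++⁺ʳ good (∈-++⁺ʳ (X ++ map swap Y) (∈-++⁺ʳ P p∈P′))
      ... | no p∉P′ = ∈-++⁺ˡ (∈-filter⁺ (switchable? A) (∈-allPairs (x , y)) (xy , x∉ , y∉ , p∉P , p∉P′))

    -- The two sides of the double count. `After` keeps only what bounds the number of pairs xy per
    -- graph: `x` is a neighbour of `a` and `y` one of `b`.
    Before After : Pred (Adj n × Pair n) _
    Before (A , p)       = All (Edge A) ((a , b) ∷ P) × Switchable A p
    After  (A , (x , y)) = All (Edge A) P × Edge A (a , x) × Edge A (b , y)

    before? : Decidable Before
    before? (A , p) = (A ⊇? ((a , b) ∷ P)) ×-dec switchable? A p

    after? : Decidable After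
    after? (A , (x , y)) = (A ⊇? P) ×-dec edge? A (a , x) ×-dec edge? A (b , y)

    move : Adj n × Pair n → Adj n × Pair n
    move (A , (x , y)) = Switch.switch a b x y A , (x , y)

    -- The pair xy is carried along, so the switching to be undone is known, and it is an
    -- involution.
    move-injective : ∀ {s t} → move s ≡ move t → s ≡ t
    move-injective {A , (x , y)} {B , (x′ , y′)} eq with cong proj₂ eq
    ... | refl = cong (_, (x , y)) (Switch.switch-injective a b x y (cong proj₁ eq))

    -- The edges of `P` survive because they differ from ab by assumption and from xy by the choice
    -- of a switchable edge.
    move-into : All ((a , b) ≁_) P → ∀ {s} → s ∈ cartesianProduct (regulars k n) (allPairs n) → Before s →
                move s ∈ cartesianProduct (regulars k n) (allPairs n) × After (move s)
    move-into fresh {A , (x , y)} s∈ (ab ∷ AP , xy , x∉ , y∉ , p∉P , p∉P′)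
      with regulars-sound k (proj₁ (∈-cartesianProduct⁻ (regulars k n) (allPairs n) s∈))
    ... | simple , reg =
      ∈-cartesianProduct⁺ (∈-regulars {A = switch A} (switch-simple′ , λ u → trans (degree-switch A u) (reg u))) (∈-allPairs (x , y)) ,
      All.map (λ { (f , xy≁ , e) → old f xy≁ e }) (All.zip (fresh , All.zip (xy-fresh , AP))) ,
      ax′ , by′
      where
      open Switch a b x y
      ¬ax : ¬ Edge A (a , x)
      ¬ax ax = x∉ (there (there (∈-neighbours A ax)))
      ¬by : ¬ Edge A (b , y)
      ¬by by = y∉ (there (there (∈-neighbours A by)))
      a≢x : a ≢ x
      a≢x refl = x∉ (here refl)
      b≢x : b ≢ x
      b≢x refl = x∉ (there (here refl))
      a≢y : a ≢ y
      a≢y refl = y∉ (here refl)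
      b≢y : b ≢ y
      b≢y refl = y∉ (there (here refl))
      switch-simple′ = switch-simple A simple ab xy ¬ax ¬by a≢x b≢x a≢y b≢y
      old : ∀ {p} → _
      old {p} = switch-old A simple ab xy ¬ax ¬by a≢x b≢x a≢y b≢y {p}
      ax′ = switch-new-ax A simple ab xy ¬ax ¬by a≢x b≢x a≢y b≢y
      by′ = switch-new-by A simple ab xy ¬ax ¬by a≢x b≢x a≢y b≢y
      xy-fresh : All ((x , y) ≁_) P
      xy-fresh = All.tabulate λ q∈P → (λ { refl → p∉P q∈P }) , (λ { refl → p∉P′ (∈-map⁺ swap q∈P) })

    -- Each graph containing `P` and ab admits at least n switchings, and each graph containing `P`
    -- arises with at most k² pairs xy.
    switching : n *ℕ 22 ≤ℕ n *ℕ k → 2 *ℕ ((2 + k) *ℕ k) ≤ℕ n → length P ≤ℕ 10 *ℕ n → All ((a , b) ≁_) P →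
                extensions ((a , b) ∷ P) *ℕ n ≤ℕ (k *ℕ k) *ℕ extensions P
    switching k≥22 n≥ P≤ fresh = begin
      extensions ((a , b) ∷ P) *ℕ n
        ≡⟨ cong (_*ℕ n) (#-∑ (_⊇? ((a , b) ∷ P)) (regulars k n)) ⟩
      ∑[ A ← regulars k n ] ⟦ A ⊇? ((a , b) ∷ P) ⟧ *ℕ n
        ≡⟨ ∑-*ʳ (regulars k n) (λ A → ⟦ A ⊇? ((a , b) ∷ P) ⟧) n ⟨
      ∑[ A ← regulars k n ] (⟦ A ⊇? ((a , b) ∷ P) ⟧ *ℕ n)
        ≤⟨ ∑-mono (regulars k n) lower ⟩
      ∑[ A ← regulars k n ] # (λ p → before? (A , p)) (allPairs n)
        ≡⟨ #-cartesianProduct before? (regulars k n) (allPairs n) ⟨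
      # before? (cartesianProduct (regulars k n) (allPairs n))
        ≤⟨ #-injection before? after? move move-injective
             (Unique.cartesianProduct⁺ (regulars-unique k n) (allPairs-unique n)) (move-into fresh) ⟩
      # after? (cartesianProduct (regulars k n) (allPairs n))
        ≡⟨ #-cartesianProduct after? (regulars k n) (allPairs n) ⟩
      ∑[ A ← regulars k n ] # (λ p → after? (A , p)) (allPairs n)
        ≤⟨ ∑-mono (regulars k n) upper ⟩
      ∑[ A ← regulars k n ] ((k *ℕ k) *ℕ ⟦ A ⊇? P ⟧)
        ≡⟨ ∑-*ˡ (regulars k n) (λ A → ⟦ A ⊇? P ⟧) (k *ℕ k) ⟩
      (k *ℕ k) *ℕ ∑[ A ← regulars k n ] ⟦ A ⊇? P ⟧
        ≡⟨ cong ((k *ℕ k) *ℕ_) (#-∑ (_⊇? P) (regulars k n)) ⟨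
      (k *ℕ k) *ℕ extensions P ∎
      where
      open ≤-Reasoning

      -- Of at least 22n ordered edges, at most n are lost near `a` and `b` and at most 20n to `P`.
      many : ∀ {A} → A ∈ regulars k n → n ≤ℕ # (switchable? A) (allPairs n)
      many {A} A∈ = +-cancelʳ-≤ (n + 20 *ℕ n) n _ (begin
        n + (n + 20 *ℕ n)   ≡⟨ twenty-two n ⟩
        n *ℕ 22             ≤⟨ k≥22 ⟩
        n *ℕ k              ≤⟨ #-switchable A (regulars-sound k {A = A} A∈) ⟩
        # (switchable? A) (allPairs n) + (2 *ℕ ((2 + k) *ℕ k) + 2 *ℕ length P)
          ≤⟨ +-monoʳ-≤ (# (switchable? A) (allPairs n)) (+-mono-≤ n≥ (≤-trans (*-monoʳ-≤ 2 P≤) (≤-reflexive (sym (*-assoc 2 10 n))))) ⟩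
        # (switchable? A) (allPairs n) + (n + 20 *ℕ n) ∎)
        where
        twenty-two : ∀ n → n + (n + 20 *ℕ n) ≡ n *ℕ 22
        twenty-two = solve-∀

      lower : ∀ {A} → A ∈ regulars k n →
              ⟦ A ⊇? ((a , b) ∷ P) ⟧ *ℕ n ≤ℕ # (λ p → before? (A , p)) (allPairs n)
      lower {A} A∈ = ⟦⟧-*-≤ (A ⊇? ((a , b) ∷ P)) λ c → ≤-trans (many A∈)
        (#-injection (switchable? A) (λ p → before? (A , p)) (λ p → p) (λ e → e) (allPairs-unique n)
          (λ p∈ s → p∈ , (c , s)))

      upper : ∀ {A} → A ∈ regulars k n →
              # (λ p → after? (A , p)) (allPairs n) ≤ℕ (k *ℕ k) *ℕ ⟦ A ⊇? P ⟧
      upper {A} A∈ = ≤-*-⟦⟧ (A ⊇? P)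
        (λ _ → begin
          # Q? (allPairs n)
            ≤⟨ length-⊆ (Unique.filter⁺ Q? (allPairs-unique n)) within ⟩
          length (cartesianProduct (neighbours A a) (neighbours A b))
            ≡⟨ length-cartesianProduct (neighbours A a) (neighbours A b) ⟩
          degree A a *ℕ degree A b
            ≡⟨ cong₂ _*ℕ_ (reg a) (reg b) ⟩
          k *ℕ k ∎)
        (λ ¬c → #-none Q? (λ _ → ¬c ∘ proj₁) (allPairs n))
        where
        reg = proj₂ (regulars-sound k {A = A} A∈)
        Q? = λ p → after? (A , p)
        within : ∀ {p} → p ∈ filter Q? (allPairs n) → p ∈ cartesianProduct (neighbours A a) (neighbours A b)
        within p∈ with proj₂ (∈-filter⁻ Q? {xs = allPairs n} p∈)
        ... | _ , ax , by = ∈-cartesianProduct⁺ (∈-neighbours A ax) (∈-neighbours A by)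

  module _ (ρ : Pair n → Pair n) (k≥22 : n *ℕ 22 ≤ℕ n *ℕ k) (n≥ : 2 *ℕ ((2 + k) *ℕ k) ≤ℕ n) where

    -- The images under `ρ` are switched away one at a time. The pairwise conditions make each of
    -- them fresh with respect to the remaining images and to `F₀`, which stays throughout.
    switching* : ∀ F F₀ → length F + length F₀ ≤ℕ 10 *ℕ n →
                 AllPairs (λ f g → ρ f ≁ ρ g) F → All (λ f → All (ρ f ≁_) F₀) F →
                 extensions (map ρ F ++ F₀) *ℕ n ^ length F ≤ℕ (k *ℕ k) ^ length F *ℕ extensions F₀
    switching* []      F₀ len _ _ = ≤-reflexive (*-comm (extensions F₀) 1)
    switching* (f ∷ F) F₀ len (fF ∷ FF) (fF₀ ∷ FF₀) = begin
      extensions (ρ f ∷ P) *ℕ (n *ℕ n ^ length F)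
        ≡⟨ *-assoc (extensions (ρ f ∷ P)) n _ ⟨
      extensions (ρ f ∷ P) *ℕ n *ℕ n ^ length F
        ≤⟨ *-monoˡ-≤ (n ^ length F) (switching (proj₁ (ρ f)) (proj₂ (ρ f)) P k≥22 n≥ P≤ (All.++⁺ (All.map⁺ fF) fF₀)) ⟩
      (k *ℕ k) *ℕ extensions P *ℕ n ^ length F
        ≡⟨ *-assoc (k *ℕ k) (extensions P) _ ⟩
      (k *ℕ k) *ℕ (extensions P *ℕ n ^ length F)
        ≤⟨ *-monoʳ-≤ (k *ℕ k) (switching* F F₀ (≤-trans (n≤1+n _) len) FF FF₀) ⟩
      (k *ℕ k) *ℕ ((k *ℕ k) ^ length F *ℕ extensions F₀)
        ≡⟨ *-assoc (k *ℕ k) _ (extensions F₀) ⟨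
      (k *ℕ k) *ℕ (k *ℕ k) ^ length F *ℕ extensions F₀ ∎
      where
      open ≤-Reasoning
      P = map ρ F ++ F₀
      P≤ : length P ≤ℕ 10 *ℕ n
      P≤ = begin
        length P                      ≡⟨ length-++ (map ρ F) ⟩
        length (map ρ F) + length F₀  ≡⟨ cong (_+ length F₀) (length-map ρ F) ⟩
        length F + length F₀          ≤⟨ ≤-trans (n≤1+n _) len ⟩
        10 *ℕ n                       ∎

-- The union bound

^-distribʳ-* : ∀ a b m → (a *ℕ b) ^ m ≡ a ^ m *ℕ b ^ m
^-distribʳ-* a b zero    = refl
^-distribʳ-* a b (suc m) = trans (cong (a *ℕ b *ℕ_) (^-distribʳ-* a b m)) (interchange* a b (a ^ m) (b ^ m))
  where
  interchange* : ∀ a b c d → a *ℕ b *ℕ (c *ℕ d) ≡ a *ℕ c *ℕ (b *ℕ d)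
  interchange* = solve-∀

m≤m^n : ∀ m n → 1 ≤ℕ m → 1 ≤ℕ n → m ≤ℕ m ^ n
m≤m^n m (suc n) 1≤m _ = ≤-trans (≤-reflexive (sym (*-identityʳ m)))
  (*-monoʳ-≤ m (m^n>0 m {{>-nonZero 1≤m}} n))

-- A list of pairs read as a finite map, the first match counting; vertices that are not keys are
-- fixed by default.
act : ∀ {n} → List (Pair n) → Fin n → Fin n
act []            w = w
act ((u , v) ∷ c) w with u ≟ w
... | yes _ = v
... | no _  = act c w

act² : ∀ {n} → (Fin n → Fin n) → Pair n → Pair n
act² α (u , v) = α u , α v

-- Both F and its image are to lie in the graph; the conditions make them disjoint as sets of
-- unordered pairs, and the image free of repetitions.
Admissible : ∀ {n} → (Pair n → Pair n) → ℕ → List (Pair n) → Set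
Admissible ρ t F = length F ≡ t × All (λ f → All (ρ f ≁_) F) F × AllPairs (λ f g → ρ f ≁ ρ g) F

admissible? : ∀ {n} (ρ : Pair n → Pair n) t → Decidable (Admissible ρ t)
admissible? ρ t F = (length F ≟ℕ t) ×-dec all? (λ f → all? (ρ f ≁?_) F) F ×-dec
                    allPairs? (λ f g → ρ f ≁? ρ g) F

keys : ∀ {n m} → Vec (Pair n) m → List (Fin n)
keys c = map proj₁ (toList c)

image : ∀ {n m} → Vec (Pair n) m → Pair n → Pair n
image c = act² (act (toList c))

-- Lists of pairs leaving a key, taken as sublists of one fixed list: a k-regular graph contains km
-- of these pairs, hence at most 2^(km) witnesses.
witnesses : ∀ {n m} → Vec (Pair n) m → List (List (Pair n))
witnesses {n} {m} c = filter (admissible? (image c) (5 *ℕ m)) (sublists (cartesianProduct (keys c) (allFin n)))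

-- A deliberate overcount of the partial permutations: all (n²)^m sequences of `m` pairs.
codes : ∀ n m → List (Vec (Pair n) m)
codes n m = vectors (allPairs n) m

-- A code lists a partial permutation; the weight of A counts the codes, together with suitable
-- lists of 5m edges, that exhibit A as almost invariant under the permutation.
weight : ∀ {n} → Adj n → ℕ
weight {n} A = ∑[ m ← map suc (upTo n) ] ∑[ c ← codes n m ] ∑[ F ← witnesses c ] ⟦ A ⊇? (map (image c) F ++ F) ⟧

module _ (k n : ℕ) (k≥22 : 22 ≤ℕ k) (n≥ : 2 *ℕ ((2 + k) *ℕ k) ≤ℕ n)
         (n≥C : (k *ℕ k) ^ 5 *ℕ 2 ^ k ≤ℕ n) (1≤n : 1 ≤ℕ n) where

  total : ℕ
  total = length (regulars k n)

  code-count : ∀ {m} → Vec (Pair n) m → ℕ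
  code-count c = ∑[ F ← witnesses c ] extensions k n (map (image c) F ++ F)

  -- Exchanging the sums, each k-regular graph is counted once for every sublist of its ordered
  -- edges leaving `us`, and there are k such edges per entry of `us`.
  ∑-extensions : ∀ us → ∑ (sublists (cartesianProduct us (allFin n))) (extensions k n) ≡ total *ℕ 2 ^ (length us *ℕ k)
  ∑-extensions us = begin
    ∑[ F ← Fs ] extensions k n F
      ≡⟨ ∑-cong (λ F → #-∑ (_⊇? F) (regulars k n)) Fs ⟩
    ∑[ F ← Fs ] ∑[ A ← regulars k n ] ⟦ A ⊇? F ⟧
      ≡⟨ ∑-swap Fs (regulars k n) (λ F A → ⟦ A ⊇? F ⟧) ⟩
    ∑[ A ← regulars k n ] ∑[ F ← Fs ] ⟦ A ⊇? F ⟧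
      ≡⟨ ∑-cong-∈ (regulars k n) each ⟩
    ∑ (regulars k n) (const (2 ^ (length us *ℕ k)))
      ≡⟨ ∑-const (regulars k n) _ ⟩
    total *ℕ 2 ^ (length us *ℕ k) ∎
    where
    open ≡-Reasoning
    Fs = sublists (cartesianProduct us (allFin n))
    each : ∀ {A} → A ∈ regulars k n → ∑[ F ← Fs ] ⟦ A ⊇? F ⟧ ≡ 2 ^ (length us *ℕ k)
    each {A} A∈ = trans (sym (#-∑ (A ⊇?_) Fs)) (trans (#-sublists (edge? A) (cartesianProduct us (allFin n)))
      (cong (2 ^_) (#-edges A (proj₂ (regulars-sound k {A = A} A∈)) us)))

  -- For each witness the 5m images are switched away, which is allowed since at most 10m pairs are
  -- prescribed in all. The sum over witnesses is then enlarged to all sublists.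
  code-bound : ∀ {m} → m ≤ℕ n → (c : Vec (Pair n) m) →
               code-count c *ℕ n ^ (5 *ℕ m) ≤ℕ (k *ℕ k) ^ (5 *ℕ m) *ℕ (total *ℕ 2 ^ (m *ℕ k))
  code-bound {m} m≤n c = begin
    code-count c *ℕ n ^ t
      ≡⟨ ∑-*ʳ (witnesses c) (λ F → extensions k n (map (image c) F ++ F)) (n ^ t) ⟨
    ∑[ F ← witnesses c ] (extensions k n (map (image c) F ++ F) *ℕ n ^ t)
      ≤⟨ ∑-mono (witnesses c) each ⟩
    ∑[ F ← witnesses c ] ((k *ℕ k) ^ t *ℕ extensions k n F)
      ≡⟨ ∑-*ˡ (witnesses c) (extensions k n) ((k *ℕ k) ^ t) ⟩
    (k *ℕ k) ^ t *ℕ ∑ (witnesses c) (extensions k n)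
      ≤⟨ *-monoʳ-≤ ((k *ℕ k) ^ t) (∑-filter (admissible? (image c) t) (sublists cands) (extensions k n)) ⟩
    (k *ℕ k) ^ t *ℕ ∑ (sublists cands) (extensions k n)
      ≡⟨ cong ((k *ℕ k) ^ t *ℕ_) (∑-extensions (keys c)) ⟩
    (k *ℕ k) ^ t *ℕ (total *ℕ 2 ^ (length (keys c) *ℕ k))
      ≡⟨ cong (λ l → (k *ℕ k) ^ t *ℕ (total *ℕ 2 ^ (l *ℕ k))) (trans (length-map proj₁ (toList c)) (Vec.length-toList c)) ⟩
    (k *ℕ k) ^ t *ℕ (total *ℕ 2 ^ (m *ℕ k)) ∎
    where
    open ≤-Reasoning
    t = 5 *ℕ m
    cands = cartesianProduct (keys c) (allFin n)
    each : ∀ {F} → F ∈ witnesses c →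
           extensions k n (map (image c) F ++ F) *ℕ n ^ t ≤ℕ (k *ℕ k) ^ t *ℕ extensions k n F
    each {F} F∈ with proj₂ (∈-filter⁻ (admissible? (image c) t) {xs = sublists cands} F∈)
    ... | len , fresh , distinct =
      subst (λ l → extensions k n (map (image c) F ++ F) *ℕ n ^ l ≤ℕ (k *ℕ k) ^ l *ℕ extensions k n F) len
        (switching* k n (image c) (*-monoʳ-≤ n k≥22) n≥ F F
          (begin
            length F + length F   ≡⟨ cong₂ _+_ len len ⟩
            5 *ℕ m + 5 *ℕ m       ≡⟨ ten m ⟩
            10 *ℕ m               ≤⟨ *-monoʳ-≤ 10 m≤n ⟩
            10 *ℕ n               ∎)
          distinct fresh)
      where
      ten : ∀ m → 5 *ℕ m + 5 *ℕ m ≡ 10 *ℕ m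
      ten = solve-∀

  -- With p = n^(2m) and q = n^m the left side is Xppq, while the right side is p C^m `total`, at
  -- most pq `total` as C ≤ n. Cancelling pq leaves Xp ≤ `total`, and p ≥ n².
  cancel-powers : ∀ X m → 1 ≤ℕ m →
                  X *ℕ n ^ (5 *ℕ m) ≤ℕ (n *ℕ n) ^ m *ℕ ((k *ℕ k) ^ (5 *ℕ m) *ℕ (total *ℕ 2 ^ (m *ℕ k))) →
                  X *ℕ (n *ℕ n) ≤ℕ total
  cancel-powers X m 1≤m le = ≤-trans (*-monoʳ-≤ X (m≤m^n (n *ℕ n) m (*-mono-≤ 1≤n 1≤n) 1≤m))
    (*-cancelˡ-≤ (p *ℕ q) {{m*n≢0 p q}} (begin
      p *ℕ q *ℕ (X *ℕ p)
        ≡⟨ shuffle₁ p q X ⟩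
      X *ℕ (p *ℕ (p *ℕ q))
        ≡⟨ cong (X *ℕ_) (sym n^5m) ⟩
      X *ℕ n ^ (5 *ℕ m)
        ≤⟨ le ⟩
      p *ℕ ((k *ℕ k) ^ (5 *ℕ m) *ℕ (total *ℕ 2 ^ (m *ℕ k)))
        ≡⟨ shuffle₂ p ((k *ℕ k) ^ (5 *ℕ m)) total (2 ^ (m *ℕ k)) ⟩
      p *ℕ ((k *ℕ k) ^ (5 *ℕ m) *ℕ 2 ^ (m *ℕ k)) *ℕ total
        ≡⟨ cong (λ z → p *ℕ z *ℕ total) C^m ⟩
      p *ℕ C ^ m *ℕ total
        ≤⟨ *-monoˡ-≤ total (*-monoʳ-≤ p (^-monoˡ-≤ m n≥C)) ⟩
      p *ℕ q *ℕ total ∎))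
    where
    open ≤-Reasoning
    p = (n *ℕ n) ^ m
    q = n ^ m
    C = (k *ℕ k) ^ 5 *ℕ 2 ^ k
    instance
      n≢0 : NonZero n
      n≢0 = >-nonZero 1≤n
      q≢0 : NonZero q
      q≢0 = m^n≢0 n m
      p≢0 : NonZero p
      p≢0 = m^n≢0 (n *ℕ n) m {{m*n≢0 n n}}
    shuffle₁ : ∀ p q X → p *ℕ q *ℕ (X *ℕ p) ≡ X *ℕ (p *ℕ (p *ℕ q))
    shuffle₁ = solve-∀
    shuffle₂ : ∀ p a r b → p *ℕ (a *ℕ (r *ℕ b)) ≡ p *ℕ (a *ℕ b) *ℕ r
    shuffle₂ = solve-∀
    n^5m : n ^ (5 *ℕ m) ≡ p *ℕ (p *ℕ q)
    n^5m = begin-equality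
      n ^ (5 *ℕ m)                       ≡⟨ ^-*-assoc n 5 m ⟨
      (n ^ 5) ^ m                        ≡⟨ cong (_^ m) (five n) ⟩
      (n *ℕ n *ℕ (n *ℕ n *ℕ n)) ^ m      ≡⟨ ^-distribʳ-* (n *ℕ n) (n *ℕ n *ℕ n) m ⟩
      p *ℕ (n *ℕ n *ℕ n) ^ m             ≡⟨ cong (p *ℕ_) (^-distribʳ-* (n *ℕ n) n m) ⟩
      p *ℕ (p *ℕ q)                      ∎
      where
      five : ∀ n → n ^ 5 ≡ n *ℕ n *ℕ (n *ℕ n *ℕ n)
      five n = unfold n
        where
        unfold : ∀ n → n *ℕ (n *ℕ (n *ℕ (n *ℕ (n *ℕ 1)))) ≡ n *ℕ n *ℕ (n *ℕ n *ℕ n)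
        unfold = solve-∀
    C^m : (k *ℕ k) ^ (5 *ℕ m) *ℕ 2 ^ (m *ℕ k) ≡ C ^ m
    C^m = begin-equality
      (k *ℕ k) ^ (5 *ℕ m) *ℕ 2 ^ (m *ℕ k)
        ≡⟨ cong₂ _*ℕ_ (^-*-assoc (k *ℕ k) 5 m) (trans (^-*-assoc 2 k m) (cong (2 ^_) (*-comm k m))) ⟨
      ((k *ℕ k) ^ 5) ^ m *ℕ (2 ^ k) ^ m
        ≡⟨ ^-distribʳ-* ((k *ℕ k) ^ 5) (2 ^ k) m ⟨
      C ^ m ∎

  -- Each of the n values of `m` contributes at most `total` / n².
  ∑-weight : ∑ (regulars k n) (weight {n}) *ℕ (n *ℕ n) ≤ℕ n *ℕ total
  ∑-weight = begin
    ∑ (regulars k n) (weight {n}) *ℕ (n *ℕ n)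
      ≡⟨ cong (_*ℕ (n *ℕ n)) exchange ⟩
    ∑[ m ← ms ] X m *ℕ (n *ℕ n)
      ≡⟨ ∑-*ʳ ms X (n *ℕ n) ⟨
    ∑[ m ← ms ] (X m *ℕ (n *ℕ n))
      ≤⟨ ∑-mono ms (λ m∈ → each (∈-map⁻ suc m∈)) ⟩
    ∑ ms (const total)
      ≡⟨ ∑-const ms total ⟩
    length ms *ℕ total
      ≡⟨ cong (_*ℕ total) (trans (length-map suc (upTo n)) (length-upTo n)) ⟩
    n *ℕ total ∎
    where
    open ≤-Reasoning
    ms = map suc (upTo n)
    X : ℕ → ℕ
    X m = ∑ (codes n m) code-count

    exchange : ∑ (regulars k n) (weight {n}) ≡ ∑ ms X
    exchange = trans (∑-swap (regulars k n) ms _) (∑-cong (λ m →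
      trans (∑-swap (regulars k n) (codes n m) _) (∑-cong (λ c →
      trans (∑-swap (regulars k n) (witnesses c) _) (∑-cong (λ F →
      sym (#-∑ (_⊇? (map (image c) F ++ F)) (regulars k n))) (witnesses c))) (codes n m))) ms)

    each : ∀ {m} → (∃ λ i → i ∈ upTo n × m ≡ suc i) → X m *ℕ (n *ℕ n) ≤ℕ total
    each {m} (i , i∈ , refl) = cancel-powers (X m) m (s≤s z≤n) (begin
      X m *ℕ n ^ (5 *ℕ m)
        ≡⟨ ∑-*ʳ (codes n m) code-count (n ^ (5 *ℕ m)) ⟨
      ∑[ c ← codes n m ] (code-count c *ℕ n ^ (5 *ℕ m))
        ≤⟨ ∑-mono (codes n m) (λ {c} _ → code-bound (∈-upTo⁻ i∈) c) ⟩
      ∑ (codes n m) (const B)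
        ≡⟨ ∑-const (codes n m) B ⟩
      length (codes n m) *ℕ B
        ≡⟨ cong (_*ℕ B) (trans (length-vectors {xs = allPairs n} m) (cong (_^ m) (trans (length-cartesianProduct (allFin n) (allFin n))
             (cong₂ _*ℕ_ (length-tabulate {n = n} _) (length-tabulate {n = n} _))))) ⟩
      (n *ℕ n) ^ m *ℕ B ∎)
      where
      B = (k *ℕ k) ^ (5 *ℕ m) *ℕ (total *ℕ 2 ^ (m *ℕ k))

  -- Markov's inequality: the average weight is at most 1/n.
  few-heavy : ∀ {As : List (Adj n)} → Unique As → All (λ A → IsSimpleRegular k A × 1 ≤ℕ weight A) As → length As *ℕ n ≤ℕ total
  few-heavy {As} As! heavy = *-cancelˡ-≤ n {{>-nonZero 1≤n}} (begin
    n *ℕ (length As *ℕ n)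
      ≡⟨ shuffle n (length As) ⟩
    length As *ℕ 1 *ℕ (n *ℕ n)
      ≡⟨ cong (_*ℕ (n *ℕ n)) (∑-const As 1) ⟨
    ∑ As (const 1) *ℕ (n *ℕ n)
      ≤⟨ *-monoˡ-≤ (n *ℕ n) (∑-mono As (λ A∈ → proj₂ (All.lookup heavy A∈))) ⟩
    ∑ As weight *ℕ (n *ℕ n)
      ≤⟨ *-monoˡ-≤ (n *ℕ n) (∑-⊆ weight As! (λ {A} A∈ → ∈-regulars {k} {A = A} (proj₁ (All.lookup heavy A∈)))) ⟩
    ∑ (regulars k n) (weight {n}) *ℕ (n *ℕ n)
      ≤⟨ ∑-weight ⟩
    n *ℕ total ∎)
    where
    open ≤-Reasoning
    shuffle : ∀ n l → n *ℕ (l *ℕ n) ≡ l *ℕ 1 *ℕ (n *ℕ n)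
    shuffle = solve-∀

-- Witnesses for graphs that are not robust

module _ {a ℓ} {X : Set a} {R : X → X → Set ℓ} (R? : Decidable₂ R)
         (conflicts : X → List X) {s} (few : ∀ x → length (conflicts x) ≤ℕ s)
         (conflict : ∀ {x y} → ¬ R x y → y ∈ conflicts x) where

  -- Choosing `x` costs `x` itself and at most `s` elements in conflict with it, hence `suc s`
  -- elements per choice.
  greedy : ∀ t {L} → Unique L → t *ℕ suc s ≤ℕ length L → ∃ λ F → F ⊆ L × length F ≡ t × AllPairs R F
  greedy zero    {L} _ _ = [] , minimum L , refl , []
  greedy (suc t) {x ∷ L} (_ ∷ L!) (s≤s le) = extend (greedy t (Unique.filter⁺ (R? x) L!) enough)
    where
    open ≤-Reasoning
    compatible = filter (R? x) L
    cover : ∀ {y} → y ∈ L → y ∈ compatible ++ conflicts x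
    cover {y} y∈ with R? x y
    ... | yes r = ∈-++⁺ˡ (∈-filter⁺ (R? x) y∈ r)
    ... | no ¬r = ∈-++⁺ʳ compatible (conflict ¬r)
    enough : t *ℕ suc s ≤ℕ length compatible
    enough = +-cancelʳ-≤ s _ _ (begin
      t *ℕ suc s + s                          ≡⟨ +-comm (t *ℕ suc s) s ⟩
      s + t *ℕ suc s                          ≤⟨ le ⟩
      length L                                ≤⟨ length-⊆ L! cover ⟩
      length (compatible ++ conflicts x)      ≡⟨ length-++ compatible ⟩
      length compatible + length (conflicts x) ≤⟨ +-monoʳ-≤ (length compatible) (few x) ⟩
      length compatible + s                   ∎)
    extend : (∃ λ F → F ⊆ compatible × length F ≡ t × AllPairs R F) → _
    extend (F , F⊆ , len , RF) =
      x ∷ F , refl ∷ ⊆-trans F⊆ (filter-⊆ (R? x) L) , cong suc len ,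
      All-resp-⊆ F⊆ (All.all-filter (R? x) L) ∷ RF

-- Passes from the pairs delivered by the greedy choice to the condition in `Admissible`, which also
-- compares members in reverse order and with themselves.
all-related : ∀ {a ℓ} {X : Set a} {S : X → X → Set ℓ} {xs} → All (λ x → S x x) xs →
              AllPairs (λ x y → S x y × S y x) xs → All (λ x → All (S x) xs) xs
all-related []         []         = []
all-related (s ∷ ss) (rs ∷ rss) =
  (s ∷ All.map proj₁ rs) ∷
  All.map (λ { ((_ , t) , ts) → t ∷ ts }) (All.zip (rs , all-related ss rss))

-- Off `us` the default of `act` is the right value exactly at fixed points, whence the alternative
-- in the hypothesis.
act-graph : ∀ {n} (ρ : Fin n → Fin n) us {w} → w ∈ us ⊎ ρ w ≡ w → act (map (λ u → u , ρ u) us) w ≡ ρ w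
act-graph ρ []       (inj₂ fix) = sym fix
act-graph ρ (u ∷ us) {w} hyp with u ≟ w
... | yes refl = refl
... | no u≢w with hyp
...   | inj₁ (here w≡u)  = ⊥-elim (u≢w (sym w≡u))
...   | inj₁ (there w∈)  = act-graph ρ us (inj₁ w∈)
...   | inj₂ fix         = act-graph ρ us (inj₂ fix)

∈-pairs : ∀ {n} {u v : Fin n} → toℕ u <ℕ toℕ v → (u , v) ∈ pairs n
∈-pairs {n} {u} {v} u<v = ∈-concatMap⁺ _ {xs = allFin n} (lose (∈-allFin u)
  (∈-map⁺ (u ,_) (∈-filter⁺ (λ v → T? (toℕ u <ᵇ toℕ v)) (∈-allFin v) (<⇒<ᵇ u<v))))

inImage⁻ : ∀ {n} (A : Adj n) π {x y} → T (inImage A π x y) → Edge A (π ⟨$⟩ˡ x , π ⟨$⟩ˡ y)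
inImage⁻ {n} A π {x} {y} t with find (any⁻ _ (allFin n) t)
... | u , _ , t′ with find (any⁻ _ (allFin n) t′)
...   | v , _ , t″ with Equivalence.to (Bool.T-∧ {adj A u v}) t″
...     | uv , eqs with Equivalence.to (Bool.T-∧ {(π ⟨$⟩ʳ u) == x}) eqs
...       | u↦x , v↦y with toWitness {a? = (π ⟨$⟩ʳ u) ≟ x} u↦x | toWitness {a? = (π ⟨$⟩ʳ v) ≟ y} v↦y
...         | refl | refl = subst (Edge A) (sym (cong₂ _,_ (inverseˡ π) (inverseˡ π))) uv

module _ {n} (α β : Fin n → Fin n) (αβ : ∀ v → α (β v) ≡ v) (βα : ∀ v → β (α v) ≡ v) where

  private
    ρ  = act² α
    ρ⁻ = act² β

  Compatible : Pair n → Pair n → Set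
  Compatible f g = (ρ f ≁ g × ρ g ≁ f) × ρ f ≁ ρ g

  compatible? : Decidable₂ Compatible
  compatible? f g = ((ρ f ≁? g) ×-dec (ρ g ≁? f)) ×-dec (ρ f ≁? ρ g)

  -- The solutions g of `ρ f` = g, `ρ g` = f and `ρ g` = `ρ f`, each up to orientation. Their number
  -- 6 is the `s` of the greedy choice.
  incompatible : Pair n → List (Pair n)
  incompatible f = ρ f ∷ swap (ρ f) ∷ ρ⁻ f ∷ swap (ρ⁻ f) ∷ f ∷ swap f ∷ []

  private
    ρ-injective : ∀ {f g} → ρ f ≡ ρ g → f ≡ g
    ρ-injective {f} {g} eq = trans (sym (ρ⁻ρ f)) (trans (cong ρ⁻ eq) (ρ⁻ρ g))
      where
      ρ⁻ρ : ∀ f → ρ⁻ (ρ f) ≡ f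
      ρ⁻ρ (u , v) = cong₂ _,_ (βα u) (βα v)

    ρρ⁻ : ∀ f → ρ (ρ⁻ f) ≡ f
    ρρ⁻ (u , v) = cong₂ _,_ (αβ u) (αβ v)

    ¬≁ : ∀ {p q : Pair n} → ¬ (p ≁ q) → p ≡ q ⊎ p ≡ swap q
    ¬≁ {p} {q} ¬p≁q with p ≟ᵖ q
    ... | yes p≡q = inj₁ p≡q
    ... | no p≢q with p ≟ᵖ swap q
    ...   | yes p≡q′ = inj₂ p≡q′
    ...   | no p≢q′  = ⊥-elim (¬p≁q (p≢q , p≢q′))

  ∈-incompatible : ∀ {f g} → ¬ Compatible f g → g ∈ incompatible f
  ∈-incompatible {f} {g} ¬c with ρ f ≁? g
  ... | no ¬1 with ¬≁ ¬1
  ...   | inj₁ e = here (sym e)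
  ...   | inj₂ e = there (here (sym (cong swap e)))
  ∈-incompatible {f} {g} ¬c | yes 1≁ with ρ g ≁? f
  ... | no ¬2 with ¬≁ ¬2
  ...   | inj₁ e = there (there (here (ρ-injective (trans e (sym (ρρ⁻ f))))))
  ...   | inj₂ e = there (there (there (here (ρ-injective (trans e (cong swap (sym (ρρ⁻ f))))))))
  ∈-incompatible {f} {g} ¬c | yes 1≁ | yes 2≁ with ρ f ≁? ρ g
  ... | no ¬3 with ¬≁ ¬3
  ...   | inj₁ e = there (there (there (there (here (sym (ρ-injective e))))))
  ...   | inj₂ e = there (there (there (there (there (here (sym (cong swap (ρ-injective {f} {swap g} e))))))))
  ∈-incompatible {f} {g} ¬c | yes 1≁ | yes 2≁ | yes 3≁ = ⊥-elim (¬c ((1≁ , 2≁) , 3≁))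

weight-lower : ∀ {n} (A : Adj n) {m} (c : Vec (Pair n) m) → 1 ≤ℕ m → m ≤ℕ n →
               ∀ {F} → F ∈ witnesses c → All (Edge A) (map (image c) F ++ F) → 1 ≤ℕ weight A
weight-lower {n} A {m} c 1≤m m≤n {F} F∈ contained = begin
  1
    ≡⟨ ⟦⟧-yes (A ⊇? (map (image c) F ++ F)) contained ⟨
  ⟦ A ⊇? (map (image c) F ++ F) ⟧
    ≤⟨ ∑-lower (λ F → ⟦ A ⊇? (map (image c) F ++ F) ⟧) F∈ ⟩
  ∑[ F ← witnesses c ] ⟦ A ⊇? (map (image c) F ++ F) ⟧
    ≤⟨ ∑-lower (λ c → ∑[ F ← witnesses c ] ⟦ A ⊇? (map (image c) F ++ F) ⟧) (∈-vectors ∈-allPairs c) ⟩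
  ∑[ c ← codes n m ] ∑[ F ← witnesses c ] ⟦ A ⊇? (map (image c) F ++ F) ⟧
    ≤⟨ ∑-lower (λ m → ∑[ c ← codes n m ] ∑[ F ← witnesses c ] ⟦ A ⊇? (map (image c) F ++ F) ⟧) (m∈ 1≤m m≤n) ⟩
  weight A ∎
  where
  open ≤-Reasoning
  m∈ : ∀ {m} → 1 ≤ℕ m → m ≤ℕ n → m ∈ map suc (upTo n)
  m∈ (s≤s _) m≤n = ∈-map⁺ suc (∈-upTo⁺ m≤n)

-- A witness from a permutation that changes few edges

module _ {k n} (A : Adj n) (regular : IsSimpleRegular k A) (k≥38 : 38 ≤ℕ k)
         (π : Permutation′ n) (few : symDiff A π <ℕ moved π) where

  private
    symm = proj₁ (proj₁ regular)
    M : List (Fin n)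
    M = filterᵇ (λ v → not ((π ⟨$⟩ʳ v) == v)) (allFin n)
    m = length M
    -- The code records the inverse of `π` on the moved points, so `ρ` takes a pair to its preimage
    -- under `π`.
    code : Vec (Pair n) m
    code = Vec.map (λ u → u , π ⟨$⟩ˡ u) (Vec.fromList M)

    toList-code : toList code ≡ map (λ u → u , π ⟨$⟩ˡ u) M
    toList-code = trans (Vec.toList-map _ (Vec.fromList M)) (cong (map _) (Vec.toList∘fromList M))

    keys-code : keys code ≡ M
    keys-code = trans (cong (map proj₁) toList-code) (trans (sym (map-∘ M)) (map-id M))

    α = act (toList code)
    β = π ⟨$⟩ʳ_
    ρ = image code

    moved-or-fixed : ∀ v → v ∈ M ⊎ π ⟨$⟩ˡ v ≡ v
    moved-or-fixed v with (π ⟨$⟩ʳ v) ≟ v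
    ... | yes fix = inj₂ (trans (cong (π ⟨$⟩ˡ_) (sym fix)) (inverseˡ π))
    ... | no move = inj₁ (∈-filter⁺ (λ v → T? (not ((π ⟨$⟩ʳ v) == v))) (∈-allFin v) (fromWitnessFalse move))

    α≗ : ∀ v → α v ≡ π ⟨$⟩ˡ v
    α≗ v = trans (cong (λ c → act c v) toList-code) (act-graph (π ⟨$⟩ˡ_) M (moved-or-fixed v))

    αβ : ∀ v → α (β v) ≡ v
    αβ v = trans (α≗ (β v)) (inverseˡ π)

    βα : ∀ v → β (α v) ≡ v
    βα v = trans (cong β (α≗ v)) (inverseʳ π)

    α-moves : ∀ {v} → v ∈ M → α v ≢ v
    α-moves {v} v∈ αv≡v =
      toWitnessFalse (proj₂ (∈-filter⁻ (λ v → T? (not ((π ⟨$⟩ʳ v) == v))) {xs = allFin n} v∈))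
        (trans (cong β (sym αv≡v)) (βα v))

    cands = cartesianProduct M (allFin n)

    Good : Pair n → Set
    Good f = Edge A f × Edge A (ρ f) × ρ f ≁ f

    good? : Decidable Good
    good? f = edge? A f ×-dec edge? A (ρ f) ×-dec (ρ f ≁? f)

    L = filter good? cands

    M! : Unique M
    M! = Unique.filter⁺ _ (Unique.allFin⁺ n)

    cands! : Unique cands
    cands! = Unique.cartesianProduct⁺ M! (Unique.allFin⁺ n)

    differ : Pair n → Bool
    differ p = adj A (proj₁ p) (proj₂ p) xor inImage A π (proj₁ p) (proj₂ p)

    D = filterᵇ differ (pairs n)

    -- An edge whose preimage is not an edge lies in the graph but not in its image.
    differ-intro : ∀ {u v} → Edge A (u , v) → ¬ Edge A (ρ (u , v)) → T (differ (u , v))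
    differ-intro {u} {v} uv ¬ρuv = Equivalence.from Bool.T-≡ (cong₂ _xor_ (T-true uv) (¬T⇒≡false λ t →
      ¬ρuv (subst (Edge A) (sym (cong₂ _,_ (α≗ u) (α≗ v))) (inImage⁻ A π t))))

    -- An ordered edge uv leaving a moved point fails to be good in two ways. If its preimage is the
    -- same unordered pair, then v = `α u` because `α` moves u, which gives at most `m` edges. If
    -- its preimage is not an edge, uv or vu is counted in `symDiff`.
    m*k≤ : m *ℕ k ≤ℕ length L + (m + (symDiff A π + symDiff A π))
    m*k≤ = begin
      m *ℕ k
        ≡⟨ #-edges A (proj₂ regular) M ⟨
      # (edge? A) cands
        ≤⟨ length-⊆ (Unique.filter⁺ (edge? A) cands!) cover ⟩
      length (L ++ map (λ v → v , α v) M ++ D ++ map swap D)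
        ≡⟨ trans (length-++ L) (cong (length L +_)
             (trans (length-++ (map (λ v → v , α v) M)) (cong₂ _+_ (length-map (λ v → v , α v) M)
               (trans (length-++ D) (cong (length D +_) (length-map swap D)))))) ⟩
      length L + (m + (symDiff A π + symDiff A π)) ∎
      where
      open ≤-Reasoning
      cover : ∀ {f} → f ∈ filter (edge? A) cands → f ∈ L ++ map (λ v → v , α v) M ++ D ++ map swap D
      cover {u , v} f∈ with ∈-filter⁻ (edge? A) {xs = cands} f∈
      ... | f∈cands , uv with edge? A (ρ (u , v)) | ρ (u , v) ≁? (u , v)
      ... | yes e | yes ρ≁ = ∈-++⁺ˡ (∈-filter⁺ good? f∈cands (uv , e , ρ≁))
      ... | yes e | no ¬ρ≁ with proj₁ (∈-cartesianProduct⁻ M (allFin n) f∈cands) | α u ≟ v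
      ...   | u∈ | yes αu≡v = ∈-++⁺ʳ L (∈-++⁺ˡ
                (subst (λ z → (u , z) ∈ map (λ v → v , α v) M) αu≡v (∈-map⁺ (λ v → v , α v) u∈)))
      ...   | u∈ | no αu≢v  = ⊥-elim (¬ρ≁ (α-moves u∈ ∘ cong proj₁ , αu≢v ∘ cong proj₁))
      cover {u , v} f∈ | f∈cands , uv | no ¬e | _ with <-cmp (toℕ u) (toℕ v)
      ...   | tri< u<v _ _ = ∈-++⁺ʳ L (∈-++⁺ʳ (map (λ v → v , α v) M) (∈-++⁺ˡ
                (∈-filter⁺ (T? ∘ differ) (∈-pairs u<v) (differ-intro uv ¬e))))
      ...   | tri≈ _ u≡v _ with Fin.toℕ-injective u≡v
      ...     | refl = ⊥-elim (subst T (proj₂ (proj₁ regular) u) uv)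
      cover {u , v} f∈ | f∈cands , uv | no ¬e | _ | tri> _ _ v<u =
        ∈-++⁺ʳ L (∈-++⁺ʳ (map (λ v → v , α v) M) (∈-++⁺ʳ D (∈-map⁺ swap
          (∈-filter⁺ (T? ∘ differ) (∈-pairs v<u)
            (differ-intro (subst T (symm u v) uv) (¬e ∘ subst T (symm (α v) (α u))))))))

    -- The source of 38: the greedy choice of 5m edges takes 7 candidates each, and at most 3m of
    -- the ordered edges are not good.
    enough : 5 *ℕ m *ℕ 7 ≤ℕ length L
    enough = +-cancelʳ-≤ (m + (m + m)) _ _ (begin
      5 *ℕ m *ℕ 7 + (m + (m + m))
        ≡⟨ thirty-eight m ⟩
      m *ℕ 38
        ≤⟨ *-monoʳ-≤ m k≥38 ⟩
      m *ℕ k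
        ≤⟨ m*k≤ ⟩
      length L + (m + (symDiff A π + symDiff A π))
        ≤⟨ +-monoʳ-≤ (length L) (+-monoʳ-≤ m (+-mono-≤ (<⇒≤ few) (<⇒≤ few))) ⟩
      length L + (m + (m + m)) ∎)
      where
      open ≤-Reasoning
      thirty-eight : ∀ m → 5 *ℕ m *ℕ 7 + (m + (m + m)) ≡ m *ℕ 38
      thirty-eight = solve-∀

    build : (∃ λ F → F ⊆ L × length F ≡ 5 *ℕ m × AllPairs (Compatible α β αβ βα) F) →
            ∃ λ F → F ∈ witnesses code × All (Edge A) (map ρ F ++ F)
    build (F , F⊆L , len , compat) =
      F ,
      ∈-filter⁺ (admissible? ρ (5 *ℕ m)) F∈sublists
        (len , all-related (All.map (proj₂ ∘ proj₂) goods) (AllPairs.map proj₁ compat) , AllPairs.map proj₂ compat) ,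
      All.++⁺ (All.map⁺ (All.map (proj₁ ∘ proj₂) goods)) (All.map proj₁ goods)
      where
      goods : All Good F
      goods = All-resp-⊆ F⊆L (All.all-filter good? cands)
      F∈sublists : F ∈ sublists (cartesianProduct (keys code) (allFin n))
      F∈sublists = ∈-sublists (subst (λ us → F ⊆ cartesianProduct us (allFin n)) (sym keys-code)
        (⊆-trans F⊆L (filter-⊆ good? cands)))

    witness : ∃ λ F → F ∈ witnesses code × All (Edge A) (map ρ F ++ F)
    witness = build (greedy {R = Compatible α β αβ βα} (compatible? α β αβ βα) (incompatible α β αβ βα) {s = 6} (λ _ → ≤-refl)
      (λ {f} {g} → ∈-incompatible α β αβ βα {f} {g}) (5 *ℕ m) {L} (Unique.filter⁺ good? cands!) enough)

    m≤n : m ≤ℕ n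
    m≤n = ≤-trans (length-filter _ (allFin n)) (≤-reflexive (length-tabulate {n = n} _))

  nonrobust⇒heavy : 1 ≤ℕ weight A
  -- `few` also provides `m` ≥ 1, as some number is smaller than `m`.
  nonrobust⇒heavy = weight-lower A code (≤-trans (s≤s z≤n) few) m≤n (proj₁ (proj₂ witness)) (proj₂ (proj₂ witness))

-- Rational form

toℚᵘ-toℚ : ∀ m → toℚᵘ (toℚ m) ≃ᵘ mkℚᵘ (ℤ.+ m) 0
toℚᵘ-toℚ m = ℚ.toℚᵘ-fromℚᵘ (mkℚᵘ (ℤ.+ m) 0)

-- A positive ε has numerator at least 1, so it is at least the reciprocal of its denominator.
toℚ≤*toℚ : ∀ {ε} → 0ℚ < ε → ∀ {b a} → b *ℕ ↧ₙ ε ≤ℕ a → toℚ b ≤ ε * toℚ a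
toℚ≤*toℚ {ε@(mkℚ p q-1 _)} (*<* 0<p) {b} {a} bq≤a = ℚ.toℚᵘ-cancel-≤ (begin
  toℚᵘ (toℚ b)              ≃⟨ toℚᵘ-toℚ b ⟩
  mkℚᵘ (ℤ.+ b) 0            ≤⟨ *≤* (cross (subst₂ ℤ._<_ (ℤ.*-zeroˡ (ℤ.+ suc q-1)) (ℤ.*-identityʳ p) 0<p)) ⟩
  toℚᵘ ε *ᵘ mkℚᵘ (ℤ.+ a) 0  ≃⟨ ℚᵘ.*-congˡ {toℚᵘ ε} (toℚᵘ-toℚ a) ⟨
  toℚᵘ ε *ᵘ toℚᵘ (toℚ a)    ≃⟨ ℚ.toℚᵘ-homo-* ε (toℚ a) ⟨
  toℚᵘ (ε * toℚ a)          ∎)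
  where
  open ℚᵘ.≤-Reasoning
  cross : ℤ.+ 0 ℤ.< p → ℤ.+ b ℤ.* ℤ.+ (suc q-1 *ℕ 1) ℤ.≤ (p ℤ.* ℤ.+ a) ℤ.* ℤ.+ 1
  cross (+<+ {n = suc p′} _) = subst₂ ℤ._≤_
    (trans (ℤ.pos-* b (suc q-1)) (cong (λ z → ℤ.+ b ℤ.* ℤ.+ z) (sym (ℕ.*-identityʳ (suc q-1)))))
    (trans (ℤ.pos-* (suc p′) a) (sym (ℤ.*-identityʳ (ℤ.+ suc p′ ℤ.* ℤ.+ a))))
    (+≤+ (ℕ.≤-trans bq≤a (ℕ.m≤m+n a (p′ *ℕ a))))

1*toℚ-mono : ∀ {a b} → a ≤ℕ b → 1ℚ * toℚ a ≤ toℚ b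
1*toℚ-mono {a} {b} a≤b = subst₂ _≤_ (sym (ℚ.*-identityˡ (toℚ a))) (ℚ.*-identityˡ (toℚ b))
  (toℚ≤*toℚ {1ℚ} (ℚ.positive⁻¹ 1ℚ) {a} {b} (ℕ.≤-trans (ℕ.≤-reflexive (ℕ.*-identityʳ a)) a≤b))

-- Failure of robustness yields no explicit permutation constructively, but a bound on the weight is
-- decidable and may be proved by contradiction.
¬robust⇒heavy : ∀ {k n} → 38 ≤ℕ k → (A : Adj n) → IsSimpleRegular k A →
                ¬ RobustlySelfOrdered 1ℚ A → 1 ≤ℕ weight A
¬robust⇒heavy k≥38 A regular ¬robust = decidable-stable (1 ℕ.≤? weight A) λ light →
  ¬robust λ π → 1*toℚ-mono (ℕ.≮⇒≥ λ few → light (nonrobust⇒heavy A regular k≥38 π few))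

-- The probability is a ratio of counts. Robustness is not decided, so the bad graphs enter as an
-- arbitrary duplicate-free list; `all` is at most as long as the list of all regular graphs.
theorem6p1 : ∃ λ (d₀ : ℕ) → ∀ (d : ℕ) → d ≥ d₀ →
    Σ ℚ λ γ → (0ℚ < γ) ×
    (∀ (ε : ℚ) → 0ℚ < ε → ∃ λ (N : ℕ) → ∀ (n : ℕ) → n ≥ N →
    Σ (List (Adj n)) λ all →
    Unique all × All (IsSimpleRegular (2 *ℕ d)) all ×
    (∀ (bad : List (Adj n)) → Unique bad →
    All (λ A → IsSimpleRegular (2 *ℕ d) A × ¬ RobustlySelfOrdered γ A) bad →
    toℚ (length bad) ≤ ε * toℚ (length all)))
theorem6p1 = 19 , λ d d≥19 → 1ℚ , ℚ.positive⁻¹ 1ℚ , λ ε 0<ε →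
  let k = 2 *ℕ d
      c₁ = 2 *ℕ ((2 + k) *ℕ k)
      c₂ = (k *ℕ k) ^ 5 *ℕ 2 ^ k
      k≥38 = ℕ.*-monoʳ-≤ 2 d≥19
  in
  -- The threshold adds the bounds needed for switching, for the union bound and for 1/n ≤ ε.
  c₁ + (c₂ + ↧ₙ ε) , λ n n≥ →
  let n≥c₁ = ℕ.≤-trans (ℕ.m≤m+n c₁ (c₂ + ↧ₙ ε)) n≥
      n≥c₂ε = ℕ.≤-trans (ℕ.m≤n+m (c₂ + ↧ₙ ε) c₁) n≥
      n≥c₂ = ℕ.≤-trans (ℕ.m≤m+n c₂ (↧ₙ ε)) n≥c₂ε
      n≥ε = ℕ.≤-trans (ℕ.m≤n+m (↧ₙ ε) c₂) n≥c₂ε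
  in
  regulars k n , regulars-unique k n , All.tabulate (regulars-sound k) ,
  λ bad bad! nonrobust → toℚ≤*toℚ {ε} 0<ε {length bad} {length (regulars k n)}
    (ℕ.≤-trans (ℕ.*-monoʳ-≤ (length bad) n≥ε)
      (few-heavy k n (ℕ.≤-trans (ℕ.m≤n+m 22 16) k≥38) n≥c₁ n≥c₂ (ℕ.≤-trans (s≤s z≤n) n≥ε) bad!
        (All.map (λ { {A} (regular , ¬robust) → regular , ¬robust⇒heavy k≥38 A regular ¬robust }) nonrobust)))
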